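{- Let $\alpha,\beta\ge 2$ be integers and let $d$ be an integer with $d\ge\alpha(\beta-2)+2$. Then there is no online algorithm for vector packing (VP) in dimension $d$ whose asymptotic competitive ratio is smaller than $$\frac{\beta}{1+\frac{\beta-2}{\alpha}}=\frac{\alpha\cdot\beta}{\alpha+\beta-2}.$$
   Context: Vector packing (VP) in dimension $d$: an item is a non-zero vector in $[0,1]^d$ with rational components. A packing of a finite collection of items is a partition of it into subsets called bins such that the vector sum of the items in every bin does not exceed $1$ in any component. For an input $L$ (a finite sequence of items), $OPT(L)$ is the minimum number of bins in a packing of the items of $L$. An online algorithm $A$ receives the items of $L$ one by one and packs each item irrevocably, before the next item is presented, into a new (empty) bin or into an already non-empty bin, keeping the packing feasible; its decisions are deterministic functions of the items presented so far (the total length of the input is not known to it). $A(L)$ denotes the number of bins $A$ uses for $L$. The asymptotic competitive ratio of $A$ is $$\lim_{K\to\infty}\ \sup_{L:\,OPT(L)\ge K}\ \frac{A(L)}{OPT(L)}\in[1,\infty].$$ The dimension $d$ is a fixed constant, known to the algorithm. -}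

module Defs where

open import Data.Integer.Base as ℤ using (+_)
import Data.Integer.Properties as ℤₚ
open import Data.List.Base using (List; []; _∷_; _∷ʳ_; concat; foldr; length)
open import Data.List.Relation.Binary.Permutation.Propositional using (_↭_)
open import Data.List.Relation.Unary.All using (All)
open import Data.Nat.Base as ℕ using (ℕ; suc; _∸_; NonZero; s≤s; z≤n; >-nonZero)
import Data.Nat.Properties as ℕₚ
open import Data.Nat.Solver using (module +-*-Solver)
open import Data.Product.Base using (_×_; ∃-syntax)
open import Data.Rational.Base as ℚ using (ℚ; 0ℚ; 1ℚ; _/_; toℚᵘ; fromℚᵘ)
import Data.Rational.Properties as ℚₚ
open import Data.Rational.Unnormalised.Base as ℚᵘ using (mkℚᵘ; *≡*)
import Data.Rational.Unnormalised.Properties as ℚᵘₚ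
open import Data.Vec.Base using (Vec; replicate; zipWith)
import Data.Vec.Relation.Unary.All as Vec
open import Level using (0ℓ)
open import Relation.Binary.PropositionalEquality
  using (_≡_; _≢_; refl; sym; trans; cong; cong₂; module ≡-Reasoning)
open import Relation.Unary using (Pred; _∈_)

-- The proof fields are irrelevant, so that an item is determined by its
-- vector.
record Item (d : ℕ) : Set where
  field
    vector   : Vec ℚ d
    .bounded : Vec.All (λ q → 0ℚ ℚ.≤ q × q ℚ.≤ 1ℚ) vector
    .nonzero : vector ≢ replicate d 0ℚ

open Item public

Bin : ℕ → Set
Bin d = List (Item d)

load : ∀ {d} → Bin d → Vec ℚ d
load {d} = foldr (λ x → zipWith ℚ._+_ (vector x)) (replicate d 0ℚ)

Feasible : ∀ {d} → Bin d → Set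
Feasible b = Vec.All (ℚ._≤ 1ℚ) (load b)

record Packing {d} (L : List (Item d)) : Set where
  field
    bins      : List (Bin d)
    partition : concat bins ↭ L
    nonempty  : All (_≢ []) bins
    feasible  : All Feasible bins

  size : ℕ
  size = length bins

-- IsOPT L n states OPT(L) = n.
IsOPT : ∀ {d} → List (Item d) → ℕ → Set
IsOPT L n = (∃[ P ] Packing.size {L = L} P ≡ n) × (∀ (P : Packing L) → n ℕ.≤ Packing.size P)

-- Places x bs bs′ : bs′ results from bs by adding x to one of the bins of bs,
-- or to a new bin.  Bins are listed in the order in which they are opened.
data Places {d} (x : Item d) : List (Bin d) → List (Bin d) → Set where
  new   : Places x [] ((x ∷ []) ∷ [])
  here  : ∀ {b bs} → Places x (b ∷ bs) ((x ∷ b) ∷ bs)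
  there : ∀ {b bs bs′} → Places x bs bs′ → Places x (b ∷ bs) (b ∷ bs′)

-- pack L is the packing held after exactly the items of L have been presented,
-- in this order.  As it depends on L only, decisions are deterministic and
-- independent of the future; step makes them irrevocable.
record OnlineAlgorithm (d : ℕ) : Set where
  field
    pack     : List (Item d) → List (Bin d)
    start    : pack [] ≡ []
    step     : ∀ L x → Places x (pack L) (pack (L ∷ʳ x))
    feasible : ∀ L → All Feasible (pack L)

  binsUsed : List (Item d) → ℕ
  binsUsed L = length (pack L)

-- An extended real x is represented by a set of rational q with x ≤ q that
-- contains every rational q with x < q; whether x itself belongs to the set is
-- immaterial.  The empty set represents ∞.
ℝ∞ : Set₁
ℝ∞ = Pred ℚ 0ℓ

infix 4 _<_
_<_ : ℝ∞ → ℚ → Set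
x < r = ∃[ q ] (q ∈ x × q ℚ.< r)

sup : Pred ℚ 0ℓ → ℝ∞
sup S q = ∀ r → r ∈ S → r ℚ.≤ q

-- For nonincreasing sequences this is the limit (for arbitrary ones it is the
-- limit superior).
lim : (ℕ → ℝ∞) → ℝ∞
lim s q = ∃[ K₀ ] (∀ K → K₀ ℕ.≤ K → q ∈ s K)

module _ {d} (A : OnlineAlgorithm d) where
  open OnlineAlgorithm A

  -- The set of all A(L)/OPT(L) with OPT(L) ≥ K.
  data Ratios (K : ℕ) : Pred ℚ 0ℓ where
    ratio : ∀ L n .{{_ : NonZero n}} → IsOPT L n → K ℕ.≤ n → + binsUsed L / n ∈ Ratios K

  supRatio : ℕ → ℝ∞
  supRatio K = sup (Ratios K)

  supRatio-nonincreasing : ∀ {K K′ q} → K ℕ.≤ K′ → q ∈ supRatio K → q ∈ supRatio K′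
  supRatio-nonincreasing K≤K′ q∈ _ (ratio L n opt K′≤n) =
    q∈ _ (ratio L n opt (ℕₚ.≤-trans K≤K′ K′≤n))

  asymptoticRatio : ℝ∞
  asymptoticRatio = lim supRatio

module _ (α β : ℕ) (2≤α : 2 ℕ.≤ α) (2≤β : 2 ℕ.≤ β) where

  α≢0 : NonZero α
  α≢0 = >-nonZero (ℕₚ.<⇒≤ 2≤α)

  α+β∸2≢0 : NonZero (α ℕ.+ β ∸ 2)
  α+β∸2≢0 = >-nonZero (ℕₚ.m<n⇒0<n∸m (ℕₚ.<⇒≤ (ℕₚ.+-mono-≤ 2≤α 2≤β)))

  denominator : ℚ
  denominator = 1ℚ ℚ.+ (+ (β ∸ 2) / α) {{α≢0}}

  denominator≢0 : ℚ.NonZero denominator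
  denominator≢0 = ℚₚ.pos⇒nonZero denominator {{ℚₚ.pos+nonNeg⇒pos 1ℚ
    ((+ (β ∸ 2) / α) {{α≢0}}) {{ℚₚ.normalize-nonNeg (β ∸ 2) α {{α≢0}}}}}}

  lowerBound : ℚ
  lowerBound = ((+ β / 1) ℚ.÷ denominator) {{denominator≢0}}

  lowerBound′ : ℚ
  lowerBound′ = (+ (α ℕ.* β) / (α ℕ.+ β ∸ 2)) {{α+β∸2≢0}}

private
  cross : ∀ a b → lowerBound′ (2 ℕ.+ a) (2 ℕ.+ b) (s≤s (s≤s z≤n)) (s≤s (s≤s z≤n))
                  ℚ.* denominator (2 ℕ.+ a) (2 ℕ.+ b) (s≤s (s≤s z≤n)) (s≤s (s≤s z≤n))
                  ≡ + (2 ℕ.+ b) / 1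
  cross a b = ℚₚ.toℚᵘ-injective (begin
    toℚᵘ (r ℚ.* (1ℚ ℚ.+ s))          ≈⟨ ℚₚ.toℚᵘ-homo-* r (1ℚ ℚ.+ s) ⟩
    toℚᵘ r ℚᵘ.* toℚᵘ (1ℚ ℚ.+ s)      ≈⟨ ℚᵘₚ.*-cong r≃ (ℚᵘₚ.≃-trans (ℚₚ.toℚᵘ-homo-+ 1ℚ s)
                                          (ℚᵘₚ.+-congʳ ℚᵘ.1ℚᵘ (ℚₚ.toℚᵘ-fromℚᵘ s′))) ⟩
    r′ ℚᵘ.* (ℚᵘ.1ℚᵘ ℚᵘ.+ s′)         ≈⟨ *≡* main ⟩
    mkℚᵘ (+ β) 0                     ≈⟨ ℚₚ.toℚᵘ-fromℚᵘ (mkℚᵘ (+ β) 0) ⟨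
    toℚᵘ (+ β / 1)                   ∎)
    where
    open ℚᵘₚ.≃-Reasoning
    α = 2 ℕ.+ a
    β = 2 ℕ.+ b
    r = lowerBound′ α β (s≤s (s≤s z≤n)) (s≤s (s≤s z≤n))
    s = + b / α
    r′ = mkℚᵘ (+ (α ℕ.* β)) (a ℕ.+ suc b)
    s′ = mkℚᵘ (+ b) (suc a)

    r≃ : toℚᵘ r ℚᵘ.≃ r′
    r≃ = ℚᵘₚ.≃-trans (ℚᵘₚ.≃-reflexive (cong toℚᵘ (ℚₚ./-cong {+ (α ℕ.* β)}
           {{α+β∸2≢0 α β (s≤s (s≤s z≤n)) (s≤s (s≤s z≤n))}} refl (ℕₚ.+-suc a (suc b)))))
                     (ℚₚ.toℚᵘ-fromℚᵘ r′)

    numerator : + 1 ℤ.* + α ℤ.+ + b ℤ.* + 1 ≡ + (α ℕ.+ b)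
    numerator = cong₂ ℤ._+_ (ℤₚ.*-identityˡ (+ α)) (ℤₚ.*-identityʳ (+ b))

    main : (+ (α ℕ.* β) ℤ.* (+ 1 ℤ.* + α ℤ.+ + b ℤ.* + 1)) ℤ.* + 1
           ≡ + β ℤ.* + (suc (a ℕ.+ suc b) ℕ.* (1 ℕ.* α))
    main = trans (ℤₚ.*-identityʳ _) (trans (cong (+ (α ℕ.* β) ℤ.*_) numerator)
      (trans (sym (ℤₚ.pos-* (α ℕ.* β) (α ℕ.+ b))) (trans (cong +_ (solve 2 (λ a b →
        ((con 2 :+ a) :* (con 2 :+ b)) :* ((con 2 :+ a) :+ b)
        := (con 2 :+ b) :* ((con 1 :+ (a :+ (con 1 :+ b))) :* (con 1 :* (con 2 :+ a))))
        refl a b)) (ℤₚ.pos-* β (suc (a ℕ.+ suc b) ℕ.* (1 ℕ.* α))))))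
      where open +-*-Solver

lowerBound≡lowerBound′ : ∀ α β 2≤α 2≤β → lowerBound α β 2≤α 2≤β ≡ lowerBound′ α β 2≤α 2≤β
lowerBound≡lowerBound′ α@(suc (suc a)) β@(suc (suc b)) 2≤α@(s≤s (s≤s z≤n)) 2≤β@(s≤s (s≤s z≤n)) = begin
  (+ β / 1) ℚ.* ℚ.1/ D       ≡⟨ cong (ℚ._* ℚ.1/ D) (cross a b) ⟨
  (r ℚ.* D) ℚ.* ℚ.1/ D       ≡⟨ ℚₚ.*-assoc r D (ℚ.1/ D) ⟩
  r ℚ.* (D ℚ.* ℚ.1/ D)       ≡⟨ cong (r ℚ.*_) (ℚₚ.*-inverseʳ D) ⟩
  r ℚ.* 1ℚ                   ≡⟨ ℚₚ.*-identityʳ r ⟩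
  r                          ∎
  where
  open ≡-Reasoning
  r D : ℚ
  r = lowerBound′ α β 2≤α 2≤β
  D = denominator α β 2≤α 2≤β
  instance
    D≢0 : ℚ.NonZero D
    D≢0 = denominator≢0 α β 2≤α 2≤β

{-# OPTIONS --safe #-}

-- In units of 1/D, every item has one large component, its stage, and a tiny
-- value ("tail") in all components from its horizon on.  The first items have
-- 1/k in component 0; after that come β - 2 phases of α stages each and a last
-- phase of one stage, where the items of a stage have 1 - δ in the component
-- of that stage.  In each stage items are presented until the algorithm has
-- opened enough new bins.  Binary search over the tails makes each item that
-- opens a bin (an opener) have a much larger tail than each other item (a
-- joiner), so that δ can be chosen between the openers' tails and any sum of
-- joiners' tails.  Hence no item fits into a bin opened in an earlier phase, at
-- most one item of a stage fits into each other bin, and the algorithm opens M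
-- bins in each of the β phases.  Offline, all joiners go to M bins together
-- with the items of the last stage, and the openers are packed separately, k or
-- α to a bin, which gives M + M/k + (β - 2) M/α bins.
module Submission where

open import Defs
open import Data.Nat.Base using (ℕ; _≤_; _+_; _*_; _∸_)
open import Data.Product.Base using (∃-syntax)
open import Relation.Nullary.Negation.Core using (¬_)

open import Data.Bool.Base using (true; false; if_then_else_)
open import Data.Empty using (⊥)
open import Data.Fin.Base using (Fin; toℕ; fromℕ<)
open import Data.Fin.Properties using (toℕ<n; toℕ-fromℕ<)
open import Data.Integer.Base as ℤ using (+_; -[1+_])
import Data.Integer.Properties as ℤₚ
open import Data.List.Base using (List; []; _∷_; _++_; _∷ʳ_; concat; drop; filter; length; map; replicate; take)
import Data.List.Properties as Listₚ
open import Data.List.Relation.Binary.Permutation.Propositional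
  using (_↭_; ↭-refl; ↭-reflexive; ↭-sym; ↭-trans; prep; module PermutationReasoning)
import Data.List.Relation.Binary.Permutation.Propositional as Perm
open import Data.List.Relation.Binary.Permutation.Propositional.Properties
  using (shift; shifts; ++-comm; ++⁺; ++⁺ˡ; ++⁺ʳ; ∷↭∷ʳ; ↭-map-inv; map⁺)
open import Data.List.Relation.Unary.All as All using (All; []; _∷_)
import Data.List.Relation.Unary.All.Properties as Allₚ
import Data.Nat.Base as ℕ
open import Data.Nat.Base using (zero; suc; z≤n; s≤s; NonZero; >-nonZero; _≤ᵇ_; _≡ᵇ_)
open import Data.Nat.Induction using (<-rec)
open import Data.Nat.Properties
open import Data.Nat.Solver using (module +-*-Solver)
open import Data.Product.Base using (_×_; _,_; proj₁)
open import Data.Rational.Base as ℚ using (ℚ; mkℚ; 0ℚ; 1ℚ; _/_; toℚᵘ)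
import Data.Rational.Properties as ℚₚ
open import Data.Rational.Unnormalised.Base as ℚᵘ using (mkℚᵘ; *≡*; *≤*)
import Data.Rational.Unnormalised.Properties as ℚᵘₚ
open import Data.Sum.Base using (_⊎_; inj₁; inj₂)
import Data.Vec.Base as Vec
open import Data.Vec.Base using (_∷_; lookup; tabulate; zipWith)
import Data.Vec.Properties as Vecₚ
import Data.Vec.Relation.Unary.All as VecAll
import Data.Vec.Relation.Unary.All.Properties as VecAllₚ
open import Function.Base using (_∘_)
open import Level using (0ℓ)
open import Relation.Binary.PropositionalEquality
  using (_≡_; _≢_; refl; sym; trans; cong; cong₂; subst; subst₂; module ≡-Reasoning)
open import Relation.Nullary using (yes; no; contradiction)
open import Relation.Unary using (Pred)
open import Algebra.Properties.CommutativeSemigroup +-commutativeSemigroup using (x∙yz≈y∙xz)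

-- Fractions with a fixed denominator, and tabulated vectors.

toℚᵘ-/ : ∀ a n → toℚᵘ (+ a / suc n) ℚᵘ.≃ mkℚᵘ (+ a) n
toℚᵘ-/ a n = ℚₚ.toℚᵘ-fromℚᵘ (mkℚᵘ (+ a) n)

/≤1⇒≤ : ∀ {a} n .{{_ : NonZero n}} → + a / n ℚ.≤ 1ℚ → a ≤ n
/≤1⇒≤ {a} n@(suc n′) a/n≤1 = ℤₚ.drop‿+≤+ (subst₂ ℤ._≤_ (ℤₚ.*-identityʳ (+ a)) (ℤₚ.*-identityˡ (+ n))
  (ℚᵘₚ.drop-*≤* (ℚᵘₚ.≤-respˡ-≃ (toℚᵘ-/ a n′) (ℚₚ.toℚᵘ-mono-≤ a/n≤1))))

≤⇒/≤1 : ∀ {a} n .{{_ : NonZero n}} → a ≤ n → + a / n ℚ.≤ 1ℚ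
≤⇒/≤1 {a} n@(suc n′) a≤n = ℚₚ.toℚᵘ-cancel-≤ (ℚᵘₚ.≤-respˡ-≃ (ℚᵘₚ.≃-sym (toℚᵘ-/ a n′))
  (*≤* (subst₂ ℤ._≤_ (sym (ℤₚ.*-identityʳ (+ a))) (sym (ℤₚ.*-identityˡ (+ n))) (ℤ.+≤+ a≤n))))

0≤/ : ∀ a n .{{_ : NonZero n}} → 0ℚ ℚ.≤ + a / n
0≤/ a n = ℚₚ.nonNegative⁻¹ (+ a / n) {{ℚₚ.normalize-nonNeg a n}}

0/ : ∀ n .{{_ : NonZero n}} → + 0 / n ≡ 0ℚ
0/ (suc n) = ℚₚ.toℚᵘ-injective (ℚᵘₚ.≃-trans (toℚᵘ-/ 0 n) (*≡* refl))

/≡0⇒≡0 : ∀ a n .{{_ : NonZero n}} → + a / n ≡ 0ℚ → a ≡ 0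
/≡0⇒≡0 a (suc n) a/n≡0 with ℚᵘₚ.≃-trans (ℚᵘₚ.≃-sym (toℚᵘ-/ a n)) (ℚₚ.toℚᵘ-cong a/n≡0)
... | *≡* eq = ℤₚ.+-injective (trans (sym (ℤₚ.*-identityʳ (+ a))) eq)

/-+ : ∀ a b n .{{_ : NonZero n}} → + a / n ℚ.+ + b / n ≡ + (a + b) / n
/-+ a b (suc n) = ℚₚ.toℚᵘ-injective (begin
  toℚᵘ (+ a / suc n ℚ.+ + b / suc n)            ≈⟨ ℚₚ.toℚᵘ-homo-+ (+ a / suc n) (+ b / suc n) ⟩
  toℚᵘ (+ a / suc n) ℚᵘ.+ toℚᵘ (+ b / suc n)    ≈⟨ ℚᵘₚ.+-cong (toℚᵘ-/ a n) (toℚᵘ-/ b n) ⟩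
  mkℚᵘ (+ a) n ℚᵘ.+ mkℚᵘ (+ b) n                ≈⟨ *≡* cross-multiplied ⟩
  mkℚᵘ (+ (a + b)) n                            ≈⟨ toℚᵘ-/ (a + b) n ⟨
  toℚᵘ (+ (a + b) / suc n)                      ∎)
  where
  open ℚᵘₚ.≃-Reasoning
  cross-multiplied : (+ a ℤ.* + suc n ℤ.+ + b ℤ.* + suc n) ℤ.* + suc n ≡ + (a + b) ℤ.* + (suc n * suc n)
  cross-multiplied = trans (cong (ℤ._* + suc n) (sym (ℤₚ.*-distribʳ-+ (+ suc n) (+ a) (+ b))))
    (trans (ℤₚ.*-assoc (+ (a + b)) (+ suc n) (+ suc n)) (cong (+ (a + b) ℤ.*_) (sym (ℤₚ.pos-* (suc n) (suc n)))))

zipWith-tabulate : ∀ {A B C : Set} (_∙_ : A → B → C) {n} (f : Fin n → A) (g : Fin n → B) →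
  zipWith _∙_ (tabulate f) (tabulate g) ≡ tabulate (λ i → f i ∙ g i)
zipWith-tabulate _∙_ {zero}  f g = refl
zipWith-tabulate _∙_ {suc n} f g = cong₂ _∷_ refl (zipWith-tabulate _∙_ (f ∘ Fin.suc) (g ∘ Fin.suc))

replicate-tabulate : ∀ {A : Set} n (x : A) → Vec.replicate n x ≡ tabulate (λ _ → x)
replicate-tabulate zero    x = refl
replicate-tabulate (suc n) x = cong (x ∷_) (replicate-tabulate n x)

-- Runs of an online algorithm on labelled items.

data Adds {P : Set} (x : P) : List (List P) → List (List P) → Set where
  new   : Adds x [] ((x ∷ []) ∷ [])
  here  : ∀ {b bs} → Adds x (b ∷ bs) ((x ∷ b) ∷ bs)
  there : ∀ {b bs bs′} → Adds x bs bs′ → Adds x (b ∷ bs) (b ∷ bs′)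

-- A placement only selects a position in the list of bins, so bins can be tracked as lists of
-- labels even if `f` sends different labels to the same item.
places⇒adds : ∀ {P : Set} {d} (f : P → Item d) {x} bs {cs} → Places (f x) (map (map f) bs) cs →
  ∃[ bs′ ] cs ≡ map (map f) bs′ × Adds x bs bs′
places⇒adds f []       new       = _ , refl , new
places⇒adds f (b ∷ bs) here      = _ , refl , here
places⇒adds f (b ∷ bs) (there p) with places⇒adds f bs p
... | bs′ , refl , a = b ∷ bs′ , refl , there a

module Online {P : Set} {d} (f : P → Item d) (A : OnlineAlgorithm d) where
  open OnlineAlgorithm A

  Reaches : List P → List (List P) → Set
  Reaches ws bs = pack (map f ws) ≡ map (map f) bs

  reaches-∷ʳ : ∀ {ws bs} x → Reaches ws bs → ∃[ bs′ ] Reaches (ws ∷ʳ x) bs′ × Adds x bs bs′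
  reaches-∷ʳ {ws} {bs} x r with places⇒adds f bs (subst (λ cs → Places (f x) cs _) r (step (map f ws) (f x)))
  ... | bs′ , eq , a = bs′ , trans (cong pack (Listₚ.map-++ f ws (x ∷ []))) eq , a

  reaches⇒feasible : ∀ {ws bs} → Reaches ws bs → All (Feasible ∘ map f) bs
  reaches⇒feasible {ws} r = Allₚ.map⁻ (subst (All Feasible) r (feasible (map f ws)))

  reaches⇒binsUsed : ∀ {ws bs} → Reaches ws bs → binsUsed (map f ws) ≡ length bs
  reaches⇒binsUsed {bs = bs} r = trans (cong length r) (Listₚ.length-map (map f) bs)

-- Items and bins in integer units.

module Pieces (d D : ℕ) {{_ : NonZero D}} where

  -- In units of 1/D: own in component stage, tail in the components from
  -- horizon on, and 0 in all others.
  record Piece : Set where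
    field
      stage horizon own tail : ℕ
      stage<horizon : stage ℕ.< horizon
      stage<d       : stage ℕ.< d
      own>0         : 0 ℕ.< own
      own≤D         : own ≤ D
      tail≤D        : tail ≤ D

  open Piece public

  abstract
    weight : ℕ → Piece → ℕ
    weight c x = if c ≡ᵇ stage x then own x else if horizon x ≤ᵇ c then tail x else 0

    weight-own : ∀ {c x} → c ≡ stage x → weight c x ≡ own x
    weight-own {c} {x} c≡s with c ≡ᵇ stage x | ≡⇒≡ᵇ c (stage x) c≡s
    ... | true | _ = refl

    weight-none : ∀ {c x} → c ≢ stage x → c ℕ.< horizon x → weight c x ≡ 0
    weight-none {c} {x} c≢s c<h with c ≡ᵇ stage x | ≡ᵇ⇒≡ c (stage x)
    ... | true  | c≡s = contradiction (c≡s _) c≢s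
    ... | false | _ with horizon x ≤ᵇ c | ≤ᵇ⇒≤ (horizon x) c
    ...   | true  | h≤c = contradiction (h≤c _) (<⇒≱ c<h)
    ...   | false | _   = refl

    weight-tail : ∀ {c x} → horizon x ≤ c → weight c x ≡ tail x
    weight-tail {c} {x} h≤c with c ≡ᵇ stage x | ≡ᵇ⇒≡ c (stage x)
    ... | true  | c≡s = contradiction (subst (horizon x ≤_) (c≡s _) h≤c) (<⇒≱ (stage<horizon x))
    ... | false | _ with horizon x ≤ᵇ c | ≤⇒≤ᵇ h≤c
    ...   | true  | _ = refl

    weight≤D : ∀ c x → weight c x ≤ D
    weight≤D c x with c ≡ᵇ stage x
    ... | true  = own≤D x
    ... | false with horizon x ≤ᵇ c
    ...   | true  = tail≤D x
    ...   | false = z≤n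

  fill : ℕ → List Piece → ℕ
  fill c []      = 0
  fill c (x ∷ b) = weight c x + fill c b

  Fit : List Piece → Set
  Fit b = ∀ c → c ℕ.< d → fill c b ≤ D

  abstract
    toItem : Piece → Item d
    toItem x = record
      { vector  = tabulate (λ i → + weight (toℕ i) x / D)
      ; bounded = VecAllₚ.tabulate⁺ (λ i → 0≤/ (weight (toℕ i) x) D , ≤⇒/≤1 D (weight≤D (toℕ i) x))
      ; nonzero = λ v≡0 → <⇒≢ (own>0 x) (sym (trans (sym (weight-own {toℕ s} {x} (toℕ-fromℕ< (stage<d x))))
                    (/≡0⇒≡0 _ D (trans (sym (Vecₚ.lookup∘tabulate _ s))
                      (trans (cong (λ v → lookup v s) v≡0) (Vecₚ.lookup-replicate s 0ℚ))))))
      }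
      where
      s : Fin d
      s = fromℕ< (stage<d x)

    load-toItem : ∀ b → load (map toItem b) ≡ tabulate (λ i → + fill (toℕ i) b / D)
    load-toItem []      = trans (replicate-tabulate d 0ℚ) (Vecₚ.tabulate-cong (λ _ → sym (0/ D)))
    load-toItem (x ∷ b) = trans (cong (zipWith ℚ._+_ (vector (toItem x))) (load-toItem b))
      (trans (zipWith-tabulate ℚ._+_ _ _) (Vecₚ.tabulate-cong (λ i → /-+ (weight (toℕ i) x) (fill (toℕ i) b) D)))

    fit⇒feasible : ∀ {b} → Fit b → Feasible (map toItem b)
    fit⇒feasible {b} fit = subst (VecAll.All (ℚ._≤ 1ℚ)) (sym (load-toItem b))
      (VecAllₚ.tabulate⁺ (λ i → ≤⇒/≤1 D (fit (toℕ i) (toℕ<n i))))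

    feasible⇒fit : ∀ {b} → Feasible (map toItem b) → Fit b
    feasible⇒fit {b} f c c<d = subst (λ c → fill c b ≤ D) (toℕ-fromℕ< c<d)
      (/≤1⇒≤ D (VecAllₚ.tabulate⁻ (subst (VecAll.All (ℚ._≤ 1ℚ)) (load-toItem b) f) (fromℕ< c<d)))

-- Dealing lists out to bins and cutting them into chunks.

module _ {A : Set} where

  -- At most one element per list, as at most one item of a stage enters an offline bin. Surplus
  -- elements are lost, which the length bound in `concat-deal` excludes.
  deal : List A → List (List A) → List (List A)
  deal []       bs       = bs
  deal (x ∷ xs) []       = []
  deal (x ∷ xs) (b ∷ bs) = (x ∷ b) ∷ deal xs bs

  length-deal : ∀ xs bs → length (deal xs bs) ≡ length bs
  length-deal []       bs       = refl
  length-deal (x ∷ xs) []       = refl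
  length-deal (x ∷ xs) (b ∷ bs) = cong suc (length-deal xs bs)

  concat-deal : ∀ xs bs → length xs ≤ length bs → concat (deal xs bs) ↭ xs ++ concat bs
  concat-deal []       bs       _         = ↭-refl
  concat-deal (x ∷ xs) (b ∷ bs) (s≤s len) =
    prep x (↭-trans (++⁺ˡ b (concat-deal xs bs len)) (shifts b xs))

  All-deal : ∀ {P : Pred A 0ℓ} {Q R : Pred (List A) 0ℓ} → (∀ {x b} → P x → Q b → R (x ∷ b)) → (∀ {b} → Q b → R b) →
    ∀ {xs bs} → All P xs → All Q bs → All R (deal xs bs)
  All-deal add keep []         qs       = All.map keep qs
  All-deal add keep (px ∷ pxs) []       = []
  All-deal add keep (px ∷ pxs) (q ∷ qs) = add px q ∷ All-deal add keep pxs qs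

  concat-replicate-[] : ∀ n → concat (replicate n (List.[] {A = A})) ≡ []
  concat-replicate-[] zero    = refl
  concat-replicate-[] (suc n) = concat-replicate-[] n

  -- The number of chunks is fixed in advance and chunks may be empty, so the number of main bins
  -- does not depend on how many joiners there are.
  chunks : ℕ → ℕ → List A → List (List A)
  chunks zero    k xs = []
  chunks (suc n) k xs = take k xs ∷ chunks n k (drop k xs)

  length-chunks : ∀ n k xs → length (chunks n k xs) ≡ n
  length-chunks zero    k xs = refl
  length-chunks (suc n) k xs = cong suc (length-chunks n k (drop k xs))

  concat-chunks : ∀ n k xs → length xs ≤ n * k → concat (chunks n k xs) ≡ xs
  concat-chunks zero    k []       _   = refl
  concat-chunks (suc n) k xs       len = trans (cong (take k xs ++_) (concat-chunks n k (drop k xs)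
    (≤-trans (≤-reflexive (Listₚ.length-drop k xs)) (m≤n+o⇒m∸n≤o (length xs) k len)))) (Listₚ.take++drop≡id k xs)

  All-chunks : ∀ {P : Pred A 0ℓ} n k {xs} → All P xs → All (λ b → All P b × length b ≤ k) (chunks n k xs)
  All-chunks zero    k         pxs = []
  All-chunks (suc n) k {xs} pxs =
    (Allₚ.take⁺ k pxs , ≤-trans (≤-reflexive (Listₚ.length-take k xs)) (m⊓n≤m k (length xs)))
    ∷ All-chunks n k (Allₚ.drop⁺ k pxs)

  Adds-length : ∀ {x : A} {bs bs′} → Adds x bs bs′ → length bs′ ≡ suc (length bs) ⊎ length bs′ ≡ length bs
  Adds-length new       = inj₁ refl
  Adds-length here      = inj₂ refl
  Adds-length (there a) with Adds-length a
  ... | inj₁ eq = inj₁ (cong suc eq)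
  ... | inj₂ eq = inj₂ (cong suc eq)

-- Intervals for the binary search.

module _ (K : ℕ) .{{_ : NonZero K}} where

  -- A game of r rounds: in each round a number ε is announced inside the
  -- current interval, and the opponent replaces one of its ends by ε.
  -- Gap r lo hi guarantees that K * lo < hi still holds after r rounds.
  Gap : ℕ → ℕ → ℕ → Set
  Gap zero    lo hi = K * lo ℕ.< hi
  Gap (suc r) lo hi = ∃[ ε ] Gap r lo ε × Gap r ε hi

  -- First `ε` is taken large enough for the game below it, then `hi` large enough for the game
  -- above `ε`, so both answers of the opponent are provided for.
  Gap-exists : ∀ r lo → ∃[ hi ] Gap r lo hi
  Gap-exists zero    lo = suc (K * lo) , ≤-refl
  Gap-exists (suc r) lo with Gap-exists r lo
  ... | ε , g with Gap-exists r ε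
  ...   | hi , g′ = hi , ε , g , g′

  Gap⇒< : ∀ r {lo hi} → Gap r lo hi → K * lo ℕ.< hi
  Gap⇒< zero    g            = g
  Gap⇒< (suc r) (ε , g , g′) = <-trans (≤-trans (Gap⇒< r g) (m≤n*m ε K)) (Gap⇒< r g′)

  Gap⇒≤ : ∀ r {lo hi} → Gap r lo hi → lo ≤ hi
  Gap⇒≤ r {lo} g = <⇒≤ (≤-<-trans (m≤n*m lo K) (Gap⇒< r g))

  Gap-raise : ∀ r {lo hi hi′} → hi ≤ hi′ → Gap r lo hi → Gap r lo hi′
  Gap-raise zero    hi≤hi′ g            = ≤-trans g hi≤hi′
  Gap-raise (suc r) hi≤hi′ (ε , g , g′) = ε , g , Gap-raise r hi≤hi′ g′

  -- A round is skipped by passing to the lower part of the interval and raising its upper end back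
  -- to `hi`.
  Gap-drop : ∀ m {r lo hi} → Gap (m + r) lo hi → Gap r lo hi
  Gap-drop zero    g            = g
  Gap-drop (suc m) {r} (ε , g , g′) = Gap-drop m (Gap-raise (m + r) (Gap⇒≤ (m + r) g′) g)

  Gap-weaken : ∀ {r r′ lo hi} → r ≤ r′ → Gap r′ lo hi → Gap r lo hi
  Gap-weaken {r} {r′} r≤r′ g = Gap-drop (r′ ∸ r) (subst (λ z → Gap z _ _) (sym (m∸n+n≡m r≤r′)) g)

-- Fill levels and closed bins.

module Loads (d D : ℕ) {{_ : NonZero D}} where
  open Pieces d D public

  fill-++ : ∀ c xs ys → fill c (xs ++ ys) ≡ fill c xs + fill c ys
  fill-++ c []       ys = refl
  fill-++ c (x ∷ xs) ys = trans (cong (weight c x ℕ.+_) (fill-++ c xs ys)) (sym (+-assoc (weight c x) _ _))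

  fill-↭ : ∀ c {xs ys} → xs ↭ ys → fill c xs ≡ fill c ys
  fill-↭ c Perm.refl         = refl
  fill-↭ c (prep x p)        = cong (weight c x ℕ.+_) (fill-↭ c p)
  fill-↭ c (Perm.swap x y p) = trans (cong (λ f → weight c x + (weight c y + f)) (fill-↭ c p))
    (x∙yz≈y∙xz (weight c x) (weight c y) _)
  fill-↭ c (Perm.trans p q)  = trans (fill-↭ c p) (fill-↭ c q)

  fill-concat-≤ : ∀ c {bs} → All (λ b → fill c b ≤ D) bs → fill c (concat bs) ≤ length bs * D
  fill-concat-≤ c []           = z≤n
  fill-concat-≤ c {b ∷ bs} (f ∷ fs) = ≤-trans (≤-reflexive (fill-++ c b (concat bs))) (+-mono-≤ f (fill-concat-≤ c fs))

  fill-Adds : ∀ c {x bs bs′} → Adds x bs bs′ → fill c (concat bs′) ≡ weight c x + fill c (concat bs)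
  fill-Adds c new  = refl
  fill-Adds c here = refl
  fill-Adds c {x} (there {b} {bs} {bs′} a) = begin
    fill c (b ++ concat bs′)                     ≡⟨ fill-++ c b (concat bs′) ⟩
    fill c b + fill c (concat bs′)               ≡⟨ cong (fill c b ℕ.+_) (fill-Adds c a) ⟩
    fill c b + (weight c x + fill c (concat bs)) ≡⟨ x∙yz≈y∙xz (fill c b) (weight c x) _ ⟩
    weight c x + (fill c b + fill c (concat bs)) ≡⟨ cong (weight c x ℕ.+_) (fill-++ c b (concat bs)) ⟨
    weight c x + fill c (b ++ concat bs)         ∎
    where
    open ≡-Reasoning

  All-Adds : ∀ {c h x bs bs′} → Adds x bs bs′ → h ≤ weight c x →
    All (λ b → h ≤ fill c b) bs → All (λ b → h ≤ fill c b) bs′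
  All-Adds {c} {x = x} new h≤x [] = ≤-trans h≤x (m≤m+n _ 0) ∷ []
  All-Adds {c} {x = x} (here {b}) h≤x (hb ∷ hbs) = ≤-trans hb (m≤n+m (fill c b) (weight c x)) ∷ hbs
  All-Adds (there a) h≤x (hb ∷ hbs) = hb ∷ All-Adds a h≤x hbs

  All-join : ∀ {c h x bs bs′} → Adds x bs bs′ → length bs′ ≡ length bs →
    All (λ b → h ≤ fill c b) bs → All (λ b → h ≤ fill c b) bs′
  All-join {c} {x = x} (here {b}) eq (hb ∷ hbs) = ≤-trans hb (m≤n+m (fill c b) (weight c x)) ∷ hbs
  All-join (there a) eq (hb ∷ hbs) = hb ∷ All-join a (suc-injective eq) hbs

  abstract
    -- A bin with more than `δ` in component `c` is closed to items with `D ∸ δ` there.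
    closed : ℕ → ℕ → List (List Piece) → ℕ
    closed δ c bs = length (filter (λ b → δ <? fill c b) bs)

    closed≤length : ∀ δ c bs → closed δ c bs ≤ length bs
    closed≤length δ c bs = Listₚ.length-filter _ bs

    closed-all : ∀ {δ c bs} → All (λ b → δ ℕ.< fill c b) bs → closed δ c bs ≡ length bs
    closed-all all = cong length (Listₚ.filter-all _ all)

    closed-[] : ∀ {δ c} → closed δ c [] ≡ 0
    closed-[] = refl

    closed-accept : ∀ {δ c b bs} → δ ℕ.< fill c b → closed δ c (b ∷ bs) ≡ suc (closed δ c bs)
    closed-accept {b = b} {bs} δ<b = cong length (Listₚ.filter-accept _ {x = b} {xs = bs} δ<b)

    closed-reject : ∀ {δ c b bs} → ¬ (δ ℕ.< fill c b) → closed δ c (b ∷ bs) ≡ closed δ c bs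
    closed-reject {b = b} {bs} δ≮b = cong length (Listₚ.filter-reject _ {x = b} {xs = bs} δ≮b)

  closed-∷-≤ : ∀ {δ c} b bs → closed δ c bs ≤ closed δ c (b ∷ bs)
  closed-∷-≤ {δ} {c} b bs with δ <? fill c b
  ... | yes δ<b = ≤-trans (n≤1+n _) (≤-reflexive (sym (closed-accept δ<b)))
  ... | no  δ≮b = ≤-reflexive (sym (closed-reject δ≮b))

  closed-Adds : ∀ {δ c x bs bs′} → Adds x bs bs′ → closed δ c bs ≤ closed δ c bs′
  closed-Adds {δ} {c} {x} new = closed-∷-≤ (x ∷ []) []
  closed-Adds {δ} {c} {x} (here {b} {bs}) with δ <? fill c b
  ... | yes δ<b = ≤-reflexive (trans (closed-accept δ<b) (sym (closed-accept (≤-trans δ<b (m≤n+m (fill c b) (weight c x))))))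
  ... | no  δ≮b = ≤-trans (≤-reflexive (closed-reject δ≮b)) (closed-∷-≤ (x ∷ b) bs)
  closed-Adds {δ} {c} (there {b} a) with δ <? fill c b
  ... | yes δ<b = subst₂ _≤_ (sym (closed-accept δ<b)) (sym (closed-accept δ<b)) (s≤s (closed-Adds a))
  ... | no  δ≮b = subst₂ _≤_ (sym (closed-reject δ≮b)) (sym (closed-reject δ≮b)) (closed-Adds a)

  -- Weight at least `D ∸ δ` forces `x` into a bin that was not closed, or into a new one; weight
  -- above `δ` then closes this bin.
  closed-suc : ∀ {δ c x bs bs′} → δ ℕ.< weight c x → D ∸ δ ≤ weight c x → All (λ b → fill c b ≤ D) bs′ →
    Adds x bs bs′ → closed δ c bs ℕ.< closed δ c bs′
  closed-suc {δ} {c} {x} δ<x _ _ new = ≤-reflexive (trans (cong suc (closed-[] {δ} {c}))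
    (sym (trans (closed-accept (≤-trans δ<x (m≤m+n (weight c x) 0))) (cong suc closed-[]))))
  closed-suc {δ} {c} {x} δ<x D∸δ≤x (f ∷ fs) (here {b} {bs}) =
    ≤-reflexive (trans (cong suc (closed-reject (≤⇒≯ b≤δ)))
      (sym (closed-accept (≤-trans δ<x (m≤m+n (weight c x) (fill c b))))))
    where
    b≤δ : fill c b ≤ δ
    b≤δ = +-cancelˡ-≤ (D ∸ δ) (fill c b) δ (≤-trans (+-monoˡ-≤ (fill c b) D∸δ≤x)
      (≤-trans f (≤-trans (m≤n+m∸n D δ) (≤-reflexive (+-comm δ (D ∸ δ))))))
  closed-suc {δ} {c} δ<x D∸δ≤x (f ∷ fs) (there {b} a) with δ <? fill c b
  ... | yes δ<b = subst₂ ℕ._<_ (sym (closed-accept δ<b)) (sym (closed-accept δ<b)) (s≤s (closed-suc δ<x D∸δ≤x fs a))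
  ... | no  δ≮b = subst₂ ℕ._<_ (sym (closed-reject δ≮b)) (sym (closed-reject δ≮b)) (closed-suc δ<x D∸δ≤x fs a)

-- A single stage against the algorithm.

module Strategy (d D K H : ℕ) {{_ : NonZero D}} .{{_ : NonZero K}} (A : OnlineAlgorithm d) (H≤D : H ≤ D) where
  open Loads d D public
  open Online toItem A public

  record Kind (s e w t : ℕ) (x : Piece) : Set where
    field
      stage≡   : stage x ≡ s
      horizon≡ : horizon x ≡ e
      own≡     : own x ≡ w
      tail≤    : tail x ≤ t

  open Kind public

  Kind-raise : ∀ {s e w t t′ x} → t ≤ t′ → Kind s e w t x → Kind s e w t′ x
  Kind-raise t≤t′ κ = record { Kind κ; tail≤ = ≤-trans (tail≤ κ) t≤t′ }

  weight-stage : ∀ {s e w t x} → Kind s e w t x → weight s x ≡ w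
  weight-stage κ = trans (weight-own (sym (stage≡ κ))) (own≡ κ)

  weight-before : ∀ {s e w t x c} → Kind s e w t x → c ≢ s → c ℕ.< e → weight c x ≡ 0
  weight-before κ c≢s c<e = weight-none (λ eq → c≢s (trans eq (stage≡ κ))) (subst (_ ℕ.<_) (sym (horizon≡ κ)) c<e)

  weight-after : ∀ {s e w t x c} → Kind s e w t x → e ≤ c → weight c x ≤ t
  weight-after κ e≤c = ≤-trans (≤-reflexive (weight-tail (subst (_≤ _) (sym (horizon≡ κ)) e≤c))) (tail≤ κ)

  -- The reason why a stage ends is left abstract: `I n bs` describes the bins after `n` items, and
  -- `I-bound` turns it into a limit on the number of items presented before `target` bins are open.
  -- The opening uses volume for this, the later stages use closed bins.
  module Play {s e w : ℕ} (s<e : s ℕ.< e) (s<d : s ℕ.< d) (0<w : 0 ℕ.< w) (w≤D : w ≤ D)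
    (I : ℕ → List (List Piece) → Set)
    (I-step : ∀ {n x bs bs′} → Kind s e w H x → Adds x bs bs′ → All Fit bs′ → I n bs → I (suc n) bs′)
    (target limit : ℕ)
    (I-bound : ∀ {n bs} → I n bs → length bs ℕ.< target → n ℕ.< limit)
    where

    -- openers are the pieces for which the algorithm opens a new bin, joiners
    -- are the others.
    record Played (rounds r lo : ℕ) (ws : List Piece) (bs : List (List Piece)) : Set where
      field
        openers joiners : List Piece
        {ws′}           : List Piece
        {bs′}           : List (List Piece)
        {lo′ hi′ n′}    : ℕ
        reaches         : Reaches ws′ bs′
        perm            : ws′ ↭ openers ++ joiners ++ ws
        hit             : length bs′ ≡ target
        invariant       : I n′ bs′
        above           : ∀ c → e ≤ c → All (λ b → hi′ ≤ fill c b) bs′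
        gap             : Gap K r lo′ hi′
        lo≤lo′          : lo ≤ lo′
        hi′≤H           : hi′ ≤ H
        openers-kind    : All (Kind s e w H) openers
        joiners-kind    : All (Kind s e w lo′) joiners
        openers-count   : length openers + length bs ≡ target
        total-count     : length openers + length joiners ≤ rounds

    piece : ∀ ε → ε ≤ H → Piece
    piece ε ε≤H = record
      { stage = s; horizon = e; own = w; tail = ε; stage<horizon = s<e; stage<d = s<d
      ; own>0 = 0<w; own≤D = w≤D; tail≤D = ≤-trans ε≤H H≤D }

    piece-kind : ∀ {ε} (ε≤H : ε ≤ H) → Kind s e w ε (piece ε ε≤H)
    piece-kind _ = record { stage≡ = refl; horizon≡ = refl; own≡ = refl; tail≤ = ≤-refl }

    weight-piece : ∀ {ε c} (ε≤H : ε ≤ H) → e ≤ c → ε ≤ weight c (piece ε ε≤H)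
    weight-piece ε≤H e≤c = ≤-reflexive (sym (weight-tail e≤c))

    -- The next tail is the `ε` of the current gap. If the item opens a bin, `ε` becomes the upper
    -- end, since all bins now hold at least `ε` from the horizon on. If it joins a bin, `ε` becomes
    -- the lower end, which bounds the tails of all joiners so far.
    play : ∀ rounds {r n lo hi ws bs} → n + rounds ≡ limit → Reaches ws bs → length bs ≤ target → I n bs →
      (∀ c → e ≤ c → All (λ b → hi ≤ fill c b) bs) → Gap K (rounds + r) lo hi → hi ≤ H → Played rounds r lo ws bs
    play rounds {r} n+ reach ≤target inv above gap hi≤H with m≤n⇒m<n∨m≡n ≤target
    play rounds {r} {ws = ws} {bs} n+ reach ≤target inv above gap hi≤H | inj₂ eq = record
      { openers = []; joiners = []; reaches = reach; perm = ↭-refl; hit = eq; invariant = inv; above = above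
      ; gap = Gap-drop K rounds gap; lo≤lo′ = ≤-refl; hi′≤H = hi≤H; openers-kind = []; joiners-kind = []
      ; openers-count = eq; total-count = z≤n }
    -- With no rounds left `n` equals `limit`, which `I-bound` forbids while the target is missed.
    play zero {n = n} n+ reach ≤target inv above gap hi≤H | inj₁ lt =
      contradiction (I-bound inv lt) (≤⇒≯ (≤-reflexive (trans (sym n+) (+-identityʳ n))))
    play (suc rounds) {r} {n} {lo} {hi} {ws} {bs} n+ reach ≤target inv above (ε , gap₁ , gap₂) hi≤H | inj₁ lt =
      respond (reaches-∷ʳ x reach)
      where
      ε≤hi : ε ≤ hi
      ε≤hi = Gap⇒≤ K (rounds + r) gap₂
      ε≤H : ε ≤ H
      ε≤H = ≤-trans ε≤hi hi≤H
      x : Piece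
      x = piece ε ε≤H
      n+′ : suc n + rounds ≡ limit
      n+′ = trans (sym (+-suc n rounds)) n+

      respond : ∃[ bs′ ] Reaches (ws ∷ʳ x) bs′ × Adds x bs bs′ → Played (suc rounds) r lo ws bs
      respond (bs′ , reach′ , adds) = continue (Adds-length adds)
        where
        inv′ : I (suc n) bs′
        inv′ = I-step (Kind-raise ε≤H (piece-kind ε≤H)) adds
          (All.map (λ {b} → feasible⇒fit {b}) (reaches⇒feasible {ws ∷ʳ x} reach′)) inv

        continue : length bs′ ≡ suc (length bs) ⊎ length bs′ ≡ length bs → Played (suc rounds) r lo ws bs
        continue (inj₁ len) = record
          { openers = x ∷ openers; joiners = joiners; reaches = reaches
          ; perm = ↭-trans perm (↭-trans (++⁺ˡ openers (↭-trans (++⁺ˡ joiners (↭-sym (∷↭∷ʳ x ws))) (shift x joiners ws)))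
                     (shift x openers (joiners ++ ws)))
          ; hit = hit; invariant = invariant; above = above′; gap = gap; lo≤lo′ = lo≤lo′; hi′≤H = hi′≤H
          ; openers-kind = Kind-raise ε≤H (piece-kind ε≤H) ∷ openers-kind; joiners-kind = joiners-kind
          ; openers-count = trans (sym (+-suc _ _)) (trans (cong (length openers ℕ.+_) (sym len)) openers-count)
          ; total-count = s≤s total-count }
          where
          open Played (play rounds n+′ reach′ (subst (_≤ target) (sym len) lt) inv′
            (λ c e≤c → All-Adds adds (weight-piece ε≤H e≤c) (All.map (≤-trans ε≤hi) (above c e≤c))) gap₁ ε≤H)
            renaming (above to above′)
        continue (inj₂ len) = record
          { openers = openers; joiners = x ∷ joiners; reaches = reaches
          ; perm = ↭-trans perm (++⁺ˡ openers (↭-trans (++⁺ˡ joiners (↭-sym (∷↭∷ʳ x ws))) (shift x joiners ws)))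
          ; hit = hit; invariant = invariant; above = above′; gap = gap
          ; lo≤lo′ = ≤-trans (Gap⇒≤ K (rounds + r) gap₁) lo≤lo′; hi′≤H = hi′≤H
          ; openers-kind = openers-kind; joiners-kind = Kind-raise lo≤lo′ (piece-kind ε≤H) ∷ joiners-kind
          ; openers-count = trans (cong (length openers ℕ.+_) (sym len)) openers-count
          ; total-count = ≤-trans (≤-reflexive (+-suc _ _)) (s≤s total-count) }
          where
          open Played (play rounds n+′ reach′ (subst (_≤ target) (sym len) ≤target) inv′
            (λ c e≤c → All-join adds len (above c e≤c)) gap₂ hi≤H)
            renaming (above to above′)

-- Stages, phases and the offline packing.

module Phases (d D K H k M V : ℕ) {{_ : NonZero D}} .{{_ : NonZero K}} (A : OnlineAlgorithm d)
  (k+d≤K : k + d ≤ K) (2H≤D : H + H ≤ D) (KH≤D : K * H ≤ D) where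

  H≤D : H ≤ D
  H≤D = ≤-trans (m≤m+n H H) 2H≤D

  open Strategy d D K H A H≤D public

  -- A bin of the offline packing before stage s of a phase with horizon e.
  record Fits (s e δ lo : ℕ) (b : List Piece) : Set where
    field
      past    : ∀ {c} → c ℕ.< s → fill c b ≤ D
      present : ∀ {c} → s ≤ c → c ℕ.< e → fill c b ≤ δ
      future  : ∀ {c} → e ≤ c → fill c b ≤ length b * lo
      short   : length b ≤ k + s

  open Fits public

  Fits-raise : ∀ {s e δ lo lo′ b} → lo ≤ lo′ → Fits s e δ lo b → Fits s e δ lo′ b
  Fits-raise {b = b} lo≤lo′ F = record { Fits F; future = λ e≤c → ≤-trans (future F e≤c) (*-monoʳ-≤ (length b) lo≤lo′) }

  Fits-skip : ∀ {s e δ lo b} → s ℕ.< e → δ ≤ D → Fits s e δ lo b → Fits (suc s) e δ lo b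
  Fits-skip {s} {e} {δ} {lo} {b} s<e δ≤D F = record
    { past = past′
    ; present = λ s<c c<e → present F (<⇒≤ s<c) c<e
    ; future = future F
    ; short = ≤-trans (short F) (+-monoʳ-≤ k (n≤1+n s)) }
    where
    past′ : ∀ {c} → c ℕ.< suc s → fill c b ≤ D
    past′ c<1+s with m≤n⇒m<n∨m≡n (≤-pred c<1+s)
    ... | inj₁ c<s  = past F c<s
    ... | inj₂ refl = ≤-trans (present F ≤-refl s<e) δ≤D

  -- In component `s` the new item takes `D ∸ δ` and the old ones at most `δ`. Before the horizon it
  -- has nothing else, and from there on it adds one more tail of at most `lo`.
  Fits-add : ∀ {s e δ lo x b} → s ℕ.< e → δ ≤ D → Kind s e (D ∸ δ) lo x → Fits s e δ lo b → Fits (suc s) e δ lo (x ∷ b)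
  Fits-add {s} {e} {δ} {lo} {x} {b} s<e δ≤D κ F = record
    { past = past′
    ; present = λ {c} s<c c<e → ≤-trans (≤-reflexive (cong (_+ fill c b) (weight-before κ (>⇒≢ s<c) c<e)))
        (present F (<⇒≤ s<c) c<e)
    ; future = λ e≤c → +-mono-≤ (weight-after κ e≤c) (future F e≤c)
    ; short = ≤-trans (s≤s (short F)) (≤-reflexive (sym (+-suc k s))) }
    where
    past′ : ∀ {c} → c ℕ.< suc s → weight c x + fill c b ≤ D
    past′ {c} c<1+s with m≤n⇒m<n∨m≡n (≤-pred c<1+s)
    ... | inj₁ c<s  = ≤-trans (≤-reflexive (cong (_+ fill c b) (weight-before κ (<⇒≢ c<s) (<-trans c<s s<e)))) (past F c<s)
    ... | inj₂ refl = ≤-trans (+-mono-≤ (≤-reflexive (weight-stage κ)) (present F ≤-refl s<e)) (≤-reflexive (m∸n+n≡m δ≤D))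

  -- The bin holds at most `k + e ≤ K` items, so its tails sum to at most `K * lo`, the threshold of
  -- the next phase.
  Fits-turn : ∀ {e e′ δ lo b} → e ≤ e′ → e ≤ d → Fits e e δ lo b → Fits e e′ (K * lo) lo b
  Fits-turn {lo = lo} e≤e′ e≤d F = record
    { past = past F
    ; present = λ e≤c _ → ≤-trans (future F e≤c) (*-monoˡ-≤ lo (≤-trans (short F) (≤-trans (+-monoʳ-≤ k e≤d) k+d≤K)))
    ; future = λ e′≤c → future F (≤-trans e≤e′ e′≤c)
    ; short = short F }

  Fits-[] : ∀ {s e δ lo} → Fits s e δ lo []
  Fits-[] = record { past = λ _ → z≤n; present = λ _ _ → z≤n; future = λ _ → z≤n; short = z≤n }

  Fits⇒Fit : ∀ {s e δ lo b} → s ≤ d → δ ≤ D → lo ≤ H → Fits s e δ lo b → Fit b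
  Fits⇒Fit {s} {e} {δ} {lo} {b} s≤d δ≤D lo≤H F c _ with c <? s
  ... | yes c<s = past F c<s
  ... | no  c≮s with c <? e
  ...   | yes c<e = ≤-trans (present F (≮⇒≥ c≮s) c<e) δ≤D
  ...   | no  c≮e = ≤-trans (future F (≮⇒≥ c≮e))
    (≤-trans (*-mono-≤ (≤-trans (short F) (≤-trans (+-monoʳ-≤ k s≤d) k+d≤K)) lo≤H) KH≤D)

  -- The position before stage s of a phase with horizon e; before this phase
  -- the algorithm had opened P bins, and it has opened t since.  The bins of
  -- the offline packing are the main bins, which get the joiners, the fresh
  -- bins, which get the openers of this phase, and the side bins with the
  -- openers of former phases.
  record State (s e P t r f q : ℕ) : Set where
    field
      {ws}              : List Piece
      {bs}              : List (List Piece)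
      {lo hi δ}         : ℕ
      main fresh sides  : List (List Piece)
      reaches           : Reaches ws bs
      opened            : length bs ≡ P + t
      above             : ∀ c → e ≤ c → All (λ b → hi ≤ fill c b) bs
      blocked           : ∀ c → s ≤ c → c ℕ.< e → P ≤ closed δ c bs
      gap               : Gap K r lo hi
      hi≤H              : hi ≤ H
      2δ<D              : δ + δ ℕ.< D
      main-length       : length main ≡ M
      main-fits         : All (Fits s e δ lo) main
      fresh-length      : length fresh ≡ f
      fresh-fits        : All (Fits s e δ H) fresh
      sides-length      : length sides ≡ q
      sides-fit         : All Fit sides
      perm              : ws ↭ concat main ++ concat fresh ++ concat sides
      volume            : V ≤ fill 0 ws

  module Stage {s e P t r f q} (S : State s e P t (M + r) f q) (s<e : s ℕ.< e) (s<d : s ℕ.< d)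
    (μ : ℕ) (t+μ≤M : t + μ ≤ M) where
    open State S

    δ≤D : δ ≤ D
    δ≤D = ≤-trans (m≤m+n δ δ) (<⇒≤ 2δ<D)

    δ<D∸δ : δ ℕ.< D ∸ δ
    δ<D∸δ = m+n≤o⇒m≤o∸n (suc δ) 2δ<D

    lo≤H : lo ≤ H
    lo≤H = ≤-trans (Gap⇒≤ K (M + r) gap) hi≤H

    -- Each item of the stage closes one more bin in component `s`, beyond the `P` blocked ones;
    -- hence `n` items require `P + n` bins. The first conjunct is carried along for the remaining
    -- stages of the phase.
    Invariant : ℕ → List (List Piece) → Set
    Invariant n bs = (∀ c → s ≤ c → c ℕ.< e → P ≤ closed δ c bs) × P + n ≤ closed δ s bs

    Invariant-step : ∀ {n x bs bs′} → Kind s e (D ∸ δ) H x → Adds x bs bs′ → All Fit bs′ →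
      Invariant n bs → Invariant (suc n) bs′
    Invariant-step {n} {x} κ adds fit (blocked , full) =
      (λ c s≤c c<e → ≤-trans (blocked c s≤c c<e) (closed-Adds adds)) ,
      ≤-trans (≤-reflexive (+-suc P n)) (≤-trans (s≤s full) (closed-suc (subst (δ ℕ.<_) (sym x≡) δ<D∸δ)
        (≤-reflexive (sym x≡)) (All.map (λ fit → fit s s<d) fit) adds))
      where
      x≡ : weight s x ≡ D ∸ δ
      x≡ = weight-stage κ

    Invariant-bound : ∀ {n bs} → Invariant n bs → length bs ℕ.< P + (t + μ) → n ℕ.< t + μ
    Invariant-bound {n} {bs} (_ , full) lt = +-cancelˡ-< P n (t + μ) (≤-<-trans (≤-trans full (closed≤length δ s bs)) lt)

    open Play {s} {e} {D ∸ δ} s<e s<d (≤-<-trans z≤n δ<D∸δ) (m∸n≤m D δ) Invariant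
      (λ {n} → Invariant-step {n}) (P + (t + μ)) (t + μ) Invariant-bound public

    played : Played (t + μ) r lo ws bs
    played = play (t + μ) refl reaches (≤-trans (≤-reflexive opened) (+-monoʳ-≤ P (m≤m+n t μ)))
      (blocked , subst (_≤ closed δ s bs) (sym (+-identityʳ P)) (blocked s ≤-refl s<e))
      -- Every stage has `M` rounds reserved; those beyond `t + μ` are discarded.
      above (Gap-weaken K (+-monoˡ-≤ r t+μ≤M) gap) hi≤H

    open Played played public renaming (reaches to reaches′; perm to perm′; above to above′; gap to gap′)

    openers-length : length openers ≡ μ
    openers-length = +-cancelʳ-≡ (P + t) (length openers) μ
      (trans (cong (length openers ℕ.+_) (sym opened)) (trans openers-count (trans (sym (+-assoc P t μ)) (+-comm (P + t) μ))))

    volume′ : V ≤ fill 0 ws′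
    volume′ = ≤-trans volume (≤-trans (m≤n+m _ (fill 0 (openers ++ joiners))) (≤-reflexive (sym
      (trans (fill-↭ 0 perm′) (trans (cong (fill 0) (sym (Listₚ.++-assoc openers joiners ws)))
        (fill-++ 0 (openers ++ joiners) ws))))))

  -- The stage has exactly `m` openers, one for each fresh bin, and at most `t + m ≤ M` joiners, at
  -- most one for each main bin.
  advance : ∀ {s e P t r m q} → s ℕ.< e → s ℕ.< d → t + m ≤ M → State s e P t (M + r) m q → State (suc s) e P (t + m) r m q
  advance {m = m} s<e s<d t+m≤M S = record
    { main = deal joiners main; fresh = deal openers fresh; sides = sides
    ; reaches = reaches′; opened = hit; above = above′
    ; blocked = λ c s<c c<e → proj₁ invariant c (<⇒≤ s<c) c<e
    ; gap = gap′; hi≤H = hi′≤H; 2δ<D = 2δ<D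
    ; main-length = trans (length-deal joiners main) main-length
    ; main-fits = All-deal (Fits-add s<e δ≤D) (Fits-skip s<e δ≤D) joiners-kind (All.map (Fits-raise lo≤lo′) main-fits)
    ; fresh-length = trans (length-deal openers fresh) fresh-length
    ; fresh-fits = All-deal (Fits-add s<e δ≤D) (Fits-skip s<e δ≤D) openers-kind fresh-fits
    ; sides-length = sides-length; sides-fit = sides-fit
    ; perm = begin
        ws′                                                                  ↭⟨ perm′ ⟩
        openers ++ joiners ++ ws                                             ↭⟨ ++⁺ˡ openers (++⁺ˡ joiners perm) ⟩
        openers ++ joiners ++ concat main ++ concat fresh ++ concat sides    ↭⟨ shifts openers joiners ⟩
        joiners ++ openers ++ concat main ++ concat fresh ++ concat sides    ↭⟨ ++⁺ˡ joiners (shifts openers (concat main)) ⟩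
        joiners ++ concat main ++ openers ++ concat fresh ++ concat sides    ≡⟨ Listₚ.++-assoc joiners (concat main) _ ⟨
        (joiners ++ concat main) ++ openers ++ concat fresh ++ concat sides
          ≡⟨ cong ((joiners ++ concat main) ++_) (Listₚ.++-assoc openers (concat fresh) _) ⟨
        (joiners ++ concat main) ++ (openers ++ concat fresh) ++ concat sides
          ↭⟨ ++⁺ (↭-sym (concat-deal joiners main joiners≤)) (++⁺ʳ (concat sides) (↭-sym (concat-deal openers fresh openers≤))) ⟩
        concat (deal joiners main) ++ concat (deal openers fresh) ++ concat sides ∎
    ; volume = volume′ }
    where
    open State S
    open Stage S s<e s<d m t+m≤M
    open PermutationReasoning
    joiners≤ : length joiners ≤ length main
    joiners≤ = ≤-trans (m≤n+m _ (length openers)) (≤-trans total-count (≤-trans t+m≤M (≤-reflexive (sym main-length))))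
    openers≤ : length openers ≤ length fresh
    openers≤ = ≤-reflexive (trans openers-length (sym fresh-length))

  -- With `δ = K * lo` all bins of the algorithm are closed from component `e` on, since they hold
  -- at least `hi > K * lo` there, whereas the main bins stay within `δ`. The fresh bins, with tails
  -- up to `H`, retire to the side bins, where `K * H ≤ D` makes them feasible.
  turn : ∀ {e P t r f q} e′ f′ → e ≤ e′ → e ≤ d → State e e P t r f q → State e e′ (P + t) 0 r f′ (f + q)
  turn {e} {P} {t} {r} {f} {q} e′ f′ e≤e′ e≤d S = record
    { δ = K * lo; main = main; fresh = replicate f′ []; sides = fresh ++ sides
    ; reaches = reaches; opened = trans opened (sym (+-identityʳ (P + t)))
    ; above = λ c e′≤c → above c (≤-trans e≤e′ e′≤c)
    ; blocked = λ c e≤c _ → ≤-reflexive (trans (sym opened) (sym (closed-all (All.map (≤-trans (Gap⇒< K r gap)) (above c e≤c)))))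
    ; gap = gap; hi≤H = hi≤H
    ; 2δ<D = ≤-trans (+-mono-<-≤ Klo<H (<⇒≤ Klo<H)) 2H≤D
    ; main-length = main-length
    ; main-fits = All.map (Fits-turn e≤e′ e≤d) main-fits
    ; fresh-length = Listₚ.length-replicate f′
    ; fresh-fits = Allₚ.replicate⁺ f′ Fits-[]
    ; sides-length = trans (Listₚ.length-++ fresh) (cong₂ _+_ fresh-length sides-length)
    ; sides-fit = Allₚ.++⁺ (All.map (Fits⇒Fit e≤d (≤-trans (m≤m+n δ δ) (<⇒≤ 2δ<D)) ≤-refl) fresh-fits) sides-fit
    ; perm = ↭-trans perm (++⁺ˡ (concat main) (↭-reflexive (trans (Listₚ.concat-++ fresh sides)
               (cong (_++ concat (fresh ++ sides)) (sym (concat-replicate-[] f′))))))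
    ; volume = volume }
    where
    open State S
    Klo<H : K * lo ℕ.< H
    Klo<H = ≤-trans (Gap⇒< K r gap) hi≤H

  record Outcome (P q : ℕ) : Set where
    field
      {ws}    : List Piece
      {bs}    : List (List Piece)
      bins    : List (List Piece)
      reaches : Reaches ws bs
      opened  : length bs ≡ P
      number  : length bins ≡ q
      fit     : All Fit bins
      perm    : ws ↭ concat bins
      volume  : V ≤ fill 0 ws

  -- No later phase has to be prepared, so the openers may go to the main bins as well. There are at
  -- most `M` items in this stage, and tails up to `H` are still harmless because `K * H ≤ D`.
  finish : ∀ {s e P r q} → s ℕ.< e → s ℕ.< d → State s e P 0 (M + r) 0 q → Outcome (P + M) (M + q)
  finish {q = q} s<e s<d S@record { fresh = [] } = record
    { bins = deal (openers ++ joiners) main ++ sides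
    ; reaches = reaches′; opened = hit
    ; number = trans (Listₚ.length-++ (deal (openers ++ joiners) main))
        (cong₂ _+_ (trans (length-deal (openers ++ joiners) main) main-length) sides-length)
    ; fit = Allₚ.++⁺ (All-deal (λ κ F → Fits⇒Fit s<d δ≤D ≤-refl (Fits-add s<e δ≤D κ F)) (λ F → Fits⇒Fit (<⇒≤ s<d) δ≤D ≤-refl F)
               (Allₚ.++⁺ openers-kind (All.map (Kind-raise (≤-trans (Gap⇒≤ K _ gap′) hi′≤H)) joiners-kind))
               (All.map (Fits-raise lo≤H) main-fits)) sides-fit
    ; perm = begin
        ws′                                                  ↭⟨ perm′ ⟩
        openers ++ joiners ++ ws                             ↭⟨ ++⁺ˡ openers (++⁺ˡ joiners perm) ⟩
        openers ++ joiners ++ concat main ++ concat sides    ≡⟨ Listₚ.++-assoc openers joiners _ ⟨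
        (openers ++ joiners) ++ concat main ++ concat sides  ≡⟨ Listₚ.++-assoc (openers ++ joiners) (concat main) _ ⟨
        ((openers ++ joiners) ++ concat main) ++ concat sides
          ↭⟨ ++⁺ʳ (concat sides) (↭-sym (concat-deal (openers ++ joiners) main all≤)) ⟩
        concat (deal (openers ++ joiners) main) ++ concat sides
          ≡⟨ Listₚ.concat-++ (deal (openers ++ joiners) main) sides ⟩
        concat (deal (openers ++ joiners) main ++ sides)     ∎
    ; volume = volume′ }
    where
    open State S
    open Stage S s<e s<d M ≤-refl
    open PermutationReasoning
    all≤ : length (openers ++ joiners) ≤ length main
    all≤ = ≤-trans (≤-reflexive (Listₚ.length-++ openers)) (≤-trans total-count (≤-reflexive (sym main-length)))
  finish _ _ record { fresh = _ ∷ _; fresh-length = () }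

-- The opening and the sequence of phases.

module Adversary (d D K H k M V : ℕ) {{_ : NonZero D}} .{{_ : NonZero K}} (A : OnlineAlgorithm d)
  (k+d≤K : k + d ≤ K) (2H≤D : H + H ≤ D) (KH≤D : K * H ≤ D) where

  open Phases d D K H k M V A k+d≤K 2H≤D KH≤D

  module Opening (u n : ℕ) (0<u : 0 ℕ.< u) (0<k : 0 ℕ.< k) (D≡ku : D ≡ k * u) (M≡nk : M ≡ n * k)
    (V≤Mu : V ≤ M * u) (0<d : 0 ℕ.< d)
    {r : ℕ} (gap₀ : Gap K (k * M + r) 1 H) where

    u≤D : u ≤ D
    u≤D = ≤-trans (m≤n*m u k {{>-nonZero 0<k}}) (≤-reflexive (sym D≡ku))

    -- A volume argument in component 0: a bin holds at most `D = k * u`, so with fewer than `M`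
    -- bins open fewer than `k * M` items have come.
    Invariant : ℕ → List (List Piece) → Set
    Invariant n bs = n * u ≤ fill 0 (concat bs) × All (λ b → fill 0 b ≤ D) bs

    Invariant-step : ∀ {n x bs bs′} → Kind 0 1 u H x → Adds x bs bs′ → All Fit bs′ →
      Invariant n bs → Invariant (suc n) bs′
    Invariant-step κ adds fit (full , _) =
      ≤-trans (+-mono-≤ (≤-reflexive (sym (weight-stage κ))) full) (≤-reflexive (sym (fill-Adds 0 adds))) ,
      All.map (λ fit → fit 0 0<d) fit

    Invariant-bound : ∀ {n bs} → Invariant n bs → length bs ℕ.< M → n ℕ.< k * M
    Invariant-bound {n} {bs} (full , fit) lt = ≤-<-trans n≤ (*-monoʳ-< k {{>-nonZero 0<k}} lt)
      where
      open ≤-Reasoning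
      n≤ : n ≤ k * length bs
      n≤ = *-cancelʳ-≤ n (k * length bs) u {{>-nonZero 0<u}} (begin
        n * u                 ≤⟨ full ⟩
        fill 0 (concat bs)    ≤⟨ fill-concat-≤ 0 fit ⟩
        length bs * D         ≡⟨ cong (length bs *_) D≡ku ⟩
        length bs * (k * u)   ≡⟨ *-assoc (length bs) k u ⟨
        length bs * k * u     ≡⟨ cong (_* u) (*-comm (length bs) k) ⟩
        k * length bs * u     ∎)

    open Play {0} {1} {u} (s≤s z≤n) 0<d 0<u u≤D Invariant (λ {n} → Invariant-step {n}) M (k * M) Invariant-bound

    played : Played (k * M) r 1 [] []
    played = play (k * M) {n = 0} refl (OnlineAlgorithm.start A) z≤n (z≤n , []) (λ _ _ → []) gap₀ ≤-refl

    open Played played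

    fill-same : ∀ {t xs} → All (Kind 0 1 u t) xs → fill 0 xs ≡ length xs * u
    fill-same []       = refl
    fill-same (κ ∷ κs) = cong₂ _+_ (weight-stage κ) (fill-same κs)

    fill-later : ∀ {t c xs} → 1 ≤ c → All (Kind 0 1 u t) xs → fill c xs ≤ length xs * t
    fill-later 1≤c []       = z≤n
    fill-later 1≤c (κ ∷ κs) = +-mono-≤ (weight-after κ 1≤c) (fill-later 1≤c κs)

    chunk-fits : ∀ {t b} → All (Kind 0 1 u t) b × length b ≤ k → Fits 1 1 0 t b
    chunk-fits (κs , len) = record
      { past = λ { {zero} _ → ≤-trans (≤-reflexive (fill-same κs)) (≤-trans (*-monoˡ-≤ u len) (≤-reflexive (sym D≡ku)))
                 ; {suc c} (s≤s ()) }
      ; present = λ 1≤c c<1 → contradiction c<1 (≤⇒≯ 1≤c)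
      ; future = λ 1≤c → fill-later 1≤c κs
      ; short = ≤-trans len (m≤m+n k 1) }

    openers-length : length openers ≡ M
    openers-length = trans (sym (+-identityʳ _)) openers-count

    -- Both kinds are packed `k` to a bin: the `M` openers into `n` fresh bins, and the at most
    -- `k * M` joiners into the `M` main bins.
    opening : State 1 1 0 M r n 0
    opening = record
      -- No component satisfies `1 ≤ c < 1`, so 0 serves as threshold until `turn` sets the one for
      -- the first phase.
      { δ = 0; main = chunks M k joiners; fresh = chunks n k openers; sides = []
      ; reaches = reaches; opened = hit; above = above
      ; blocked = λ c 1≤c c<1 → contradiction c<1 (≤⇒≯ 1≤c)
      ; gap = gap; hi≤H = hi′≤H; 2δ<D = ≤-trans 0<u u≤D
      ; main-length = length-chunks M k joiners
      ; main-fits = All.map chunk-fits (All-chunks M k joiners-kind)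
      ; fresh-length = length-chunks n k openers
      ; fresh-fits = All.map chunk-fits (All-chunks n k openers-kind)
      ; sides-length = refl; sides-fit = []
      ; perm = ↭-trans perm (↭-trans (↭-reflexive (cong (openers ++_) (Listₚ.++-identityʳ joiners)))
          (↭-trans (++-comm openers joiners) (↭-reflexive (cong₂ _++_ (sym (concat-chunks M k joiners joiners≤))
            (trans (sym (concat-chunks n k openers openers≤)) (sym (Listₚ.++-identityʳ _)))))))
      ; volume = ≤-trans V≤Mu (≤-trans
          (≤-reflexive (trans (cong (_* u) (sym openers-length)) (sym (fill-same openers-kind))))
          (≤-trans (m≤m+n (fill 0 openers) (fill 0 (joiners ++ [])))
            (≤-reflexive (sym (trans (fill-↭ 0 perm) (fill-++ 0 openers (joiners ++ [])))))))
      }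
      where
      joiners≤ : length joiners ≤ M * k
      joiners≤ = ≤-trans (m≤n+m _ (length openers)) (≤-trans total-count (≤-reflexive (*-comm k M)))
      openers≤ : length openers ≤ n * k
      openers≤ = ≤-reflexive (trans openers-length M≡nk)

  phase : ∀ j {s P t r m q} → j + s ≤ d → t + j * m ≤ M →
    State s (j + s) P t (j * M + r) m q → State (j + s) (j + s) P (t + j * m) r m q
  phase zero    {P = P} {t} {r} {m} {q} _ _ S = subst (λ t → State _ _ P t r m q) (sym (+-identityʳ t)) S
  phase (suc j) {s} {P} {t} {r} {m} {q} 1+j+s≤d t+≤M S =
    subst₂ (λ e t → State e e P t r m q) (+-suc j s) (+-assoc t m (j * m))
      (phase j (≤-trans (≤-reflexive (+-suc j s)) 1+j+s≤d) (≤-trans (≤-reflexive (+-assoc t m (j * m))) t+≤M)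
        (subst (λ e → State (suc s) e P (t + m) (j * M + r) m q) (sym (+-suc j s))
          (advance s<1+j+s (≤-trans s<1+j+s 1+j+s≤d) (≤-trans (+-monoʳ-≤ t (m≤m+n m (j * m))) t+≤M)
            (subst (λ r → State s (suc j + s) P t r m q) (+-assoc M (j * M) r) S))))
    where
    s<1+j+s : s ℕ.< suc j + s
    s<1+j+s = s≤s (m≤n+m s j)

  -- Between phases only the sums matter: `turn` blocks all `P + t` bins of the algorithm and makes
  -- side bins of all `f + q` others.
  record Boundary (o opened closing r : ℕ) : Set where
    field
      {P t f q} : ℕ
      P+t≡      : P + t ≡ opened
      f+q≡      : f + q ≡ closing
      state     : State o o P t r f q

  -- A phase consists of `α` stages with `m` openers each. It costs the algorithm `α * m = M` bins
  -- and the offline packing only `m`, as each fresh bin takes one opener per stage.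
  phases : ∀ α m → M ≡ α * m → ∀ j {o n l r} → j * α + o ≤ d →
    Boundary o n l (j * (α * M) + r) → Boundary (j * α + o) (n + j * M) (l + j * m) r
  phases α m M≡αm zero    _ B = record
    { P+t≡ = trans P+t≡ (sym (+-identityʳ _)); f+q≡ = trans f+q≡ (sym (+-identityʳ _)); state = state }
    where open Boundary B
  phases α m M≡αm (suc j) {o} {n} {l} {r} ≤d B =
    subst (λ o → Boundary o (n + suc j * M) (l + suc j * m) r) o≡
      (subst₂ (λ n l → Boundary (j * α + (α + o)) n l r) (+-assoc n M (j * M)) (+-assoc l m (j * m))
        (phases α m M≡αm j (≤-trans (≤-reflexive o≡) ≤d) B′))
    where
    open Boundary B
    o≡ : j * α + (α + o) ≡ suc j * α + o
    o≡ = trans (sym (+-assoc (j * α) α o)) (cong (_+ o) (+-comm (j * α) α))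
    α+o≤d : α + o ≤ d
    α+o≤d = ≤-trans (m≤n+m (α + o) (j * α)) (≤-trans (≤-reflexive o≡) ≤d)
    S′ : State o (α + o) (P + t) 0 (α * M + (j * (α * M) + r)) m (f + q)
    S′ = turn (α + o) m (m≤n+m o α) (≤-trans (m≤n+m o α) α+o≤d)
           (subst (λ r → State o o P t r f q) (+-assoc (α * M) (j * (α * M)) r) state)
    B′ : Boundary (α + o) (n + M) (l + m) (j * (α * M) + r)
    B′ = record
      { P+t≡ = cong₂ _+_ P+t≡ (sym M≡αm)
      ; f+q≡ = trans (+-comm m (f + q)) (cong (_+ m) f+q≡)
      ; state = phase α α+o≤d (≤-reflexive (sym M≡αm)) S′ }

  final : ∀ {o n l} → o ℕ.< d → Boundary o n l (M + 0) → Outcome (n + M) (M + l)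
  final {o} o<d B = subst₂ (λ n l → Outcome (n + M) (M + l)) P+t≡ f+q≡
    (finish ≤-refl o<d (turn (suc o) 0 (n≤1+n o) (<⇒≤ o<d) state))
    where open Boundary B

-- Packings without empty bins, and optimal values.

dropEmpty : ∀ {A : Set} → List (List A) → List (List A)
dropEmpty []             = []
dropEmpty ([] ∷ bs)      = dropEmpty bs
dropEmpty ((x ∷ b) ∷ bs) = (x ∷ b) ∷ dropEmpty bs

concat-dropEmpty : ∀ {A : Set} (bs : List (List A)) → concat (dropEmpty bs) ≡ concat bs
concat-dropEmpty []             = refl
concat-dropEmpty ([] ∷ bs)      = concat-dropEmpty bs
concat-dropEmpty ((x ∷ b) ∷ bs) = cong ((x ∷ b) ++_) (concat-dropEmpty bs)

length-dropEmpty : ∀ {A : Set} (bs : List (List A)) → length (dropEmpty bs) ≤ length bs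
length-dropEmpty []             = z≤n
length-dropEmpty ([] ∷ bs)      = m≤n⇒m≤1+n (length-dropEmpty bs)
length-dropEmpty ((x ∷ b) ∷ bs) = s≤s (length-dropEmpty bs)

dropEmpty-nonempty : ∀ {A : Set} (bs : List (List A)) → All (_≢ []) (dropEmpty bs)
dropEmpty-nonempty []             = []
dropEmpty-nonempty ([] ∷ bs)      = dropEmpty-nonempty bs
dropEmpty-nonempty ((x ∷ b) ∷ bs) = (λ ()) ∷ dropEmpty-nonempty bs

All-dropEmpty : ∀ {A : Set} {P : List A → Set} {bs} → All P bs → All P (dropEmpty bs)
All-dropEmpty []                            = []
All-dropEmpty {bs = [] ∷ _}      (_ ∷ ps)   = All-dropEmpty ps
All-dropEmpty {bs = (_ ∷ _) ∷ _} (p ∷ ps)   = p ∷ All-dropEmpty ps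

-- The offline construction does not track nonemptiness; removing empty bins ensures it without
-- raising the count.
packing : ∀ {d} {L : List (Item d)} {n} bins → length bins ≤ n → concat bins ↭ L → All Feasible bins →
  ∃[ P ] Packing.size {L = L} P ≤ n
packing bins bins≤n bins↭L feasible = record
  { bins = dropEmpty bins; partition = ↭-trans (↭-reflexive (concat-dropEmpty bins)) bins↭L
  ; nonempty = dropEmpty-nonempty bins; feasible = All-dropEmpty feasible } , ≤-trans (length-dropEmpty bins) bins≤n

-- By strong induction on the size: a packing with none smaller is optimal. The double negation
-- avoids a search through all packings and suffices for refuting an algorithm.
¬¬IsOPT : ∀ {d} {L : List (Item d)} → Packing L → ¬ (∀ n → ¬ IsOPT L n)
¬¬IsOPT {L = L} P₀ none = <-rec (λ n → (P : Packing L) → Packing.size P ≡ n → ⊥) smaller _ P₀ refl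
  where
  smaller : ∀ n → (∀ {m} → m ℕ.< n → (P : Packing L) → Packing.size P ≡ m → ⊥) →
    (P : Packing L) → Packing.size P ≡ n → ⊥
  smaller n rec P size≡n = none n ((P , size≡n) , λ P′ → ≮⇒≥ (λ lt → rec lt P′ refl))

-- The volume bound and the hard input.

module _ {A B : Set} (f : A → B) where

  map-++⁻ : ∀ xs {ys} zs → xs ++ ys ≡ map f zs →
    ∃[ xs′ ] ∃[ ys′ ] xs ≡ map f xs′ × ys ≡ map f ys′ × xs′ ++ ys′ ≡ zs
  map-++⁻ []       zs       eq = [] , zs , refl , eq , refl
  map-++⁻ (x ∷ xs) (z ∷ zs) eq with map-++⁻ xs zs (Listₚ.∷-injectiveʳ eq)
  ... | xs′ , ys′ , xs≡ , ys≡ , zs≡ = z ∷ xs′ , ys′ , cong₂ _∷_ (Listₚ.∷-injectiveˡ eq) xs≡ , ys≡ , cong (z ∷_) zs≡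

  -- An arbitrary packing consists of items, while `fill` is defined for pieces; this pulls its bins
  -- back.
  map-concat⁻ : ∀ xss zs → concat xss ≡ map f zs → ∃[ zss ] xss ≡ map (map f) zss × concat zss ≡ zs
  map-concat⁻ []         []  eq = [] , refl , refl
  map-concat⁻ (xs ∷ xss) zs eq with map-++⁻ xs zs eq
  ... | xs′ , ys′ , xs≡ , ys≡ , zs≡ with map-concat⁻ xss ys′ ys≡
  ...   | zss , xss≡ , ys′≡ = xs′ ∷ zss , cong₂ _∷_ xs≡ xss≡ , trans (cong (xs′ ++_) ys′≡) zs≡

module _ (d D : ℕ) {{_ : NonZero D}} (0<d : 0 ℕ.< d) where
  open Loads d D

  volume-bound : ∀ {ws} (P : Packing (map toItem ws)) → fill 0 ws ≤ Packing.size P * D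
  volume-bound {ws} P = bound (↭-map-inv toItem (↭-sym (Packing.partition P)))
    where
    bound : ∃[ ys ] concat (Packing.bins P) ≡ map toItem ys × ws ↭ ys → fill 0 ws ≤ Packing.size P * D
    bound (ys , eq , ws↭ys) = bound′ (map-concat⁻ toItem (Packing.bins P) ys eq)
      where
      bound′ : ∃[ bs ] Packing.bins P ≡ map (map toItem) bs × concat bs ≡ ys → fill 0 ws ≤ Packing.size P * D
      bound′ (bs , bins≡ , concat≡) = begin
        fill 0 ws            ≡⟨ fill-↭ 0 ws↭ys ⟩
        fill 0 ys            ≡⟨ cong (fill 0) concat≡ ⟨
        fill 0 (concat bs)   ≤⟨ fill-concat-≤ 0 fits ⟩
        length bs * D        ≡⟨ cong (_* D) (trans (cong length bins≡) (Listₚ.length-map (map toItem) bs)) ⟨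
        Packing.size P * D   ∎
        where
        open ≤-Reasoning
        fits : All (λ b → fill 0 b ≤ D) bs
        fits = All.map (λ {b} F → feasible⇒fit {b} F 0 0<d)
          (Allₚ.map⁻ (subst (All Feasible) bins≡ (Packing.feasible P)))

-- Here `b` is β - 2 and M = α k N, a multiple of both α and k. The algorithm uses β M bins, against
-- M + M/k + b M/α offline. The lower bound `N` serves to make OPT as large as desired.
HardInput : ∀ {d} → OnlineAlgorithm d → (α b k N : ℕ) → Set
HardInput A α b k N = ∃[ L ]
  OnlineAlgorithm.binsUsed A L ≡ (2 + b) * (α * (k * N)) ×
  (∃[ P ] Packing.size {L = L} P ≤ N * (k * (α + b) + α)) ×
  (∀ (P : Packing L) → N ≤ Packing.size P)

module Scaled (d D K H k N α b u : ℕ) {{_ : NonZero D}} .{{_ : NonZero K}} (A : OnlineAlgorithm d)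
  (k+d≤K : k + d ≤ K) (2H≤D : H + H ≤ D) (KH≤D : K * H ≤ D)
  (0<α : 0 ℕ.< α) (αb+2≤d : α * b + 2 ≤ d) (0<k : 0 ℕ.< k) (0<u : 0 ℕ.< u) (D≡ku : D ≡ k * u)
  (gap₀ : Gap K (k * (α * (k * N)) + (b * (α * (α * (k * N))) + (α * (k * N) + 0))) 1 H)
  where

  m M : ℕ
  m = k * N
  M = α * m

  0<d : 0 ℕ.< d
  0<d = ≤-trans (s≤s z≤n) (≤-trans (m≤n+m 2 (α * b)) αb+2≤d)

  M≡ : M ≡ α * N * k
  M≡ = trans (cong (α *_) (*-comm k N)) (sym (*-assoc α N k))

  V≤ : N * D ≤ M * u
  V≤ = ≤-trans (≤-reflexive (trans (cong (N *_) D≡ku) (trans (sym (*-assoc N k u)) (cong (_* u) (*-comm N k)))))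
    (*-monoˡ-≤ u (m≤n*m m α {{>-nonZero 0<α}}))

  open Adversary d D K H k M (N * D) A k+d≤K 2H≤D KH≤D
  open Phases d D K H k M (N * D) A k+d≤K 2H≤D KH≤D
  open Opening u (α * N) 0<u 0<k D≡ku M≡ V≤ 0<d gap₀ using (opening)

  bα+1<d : b * α + 1 ℕ.< d
  bα+1<d = ≤-trans (≤-reflexive (trans (sym (+-suc (b * α) 1)) (cong (_+ 2) (*-comm b α)))) αb+2≤d

  module _ (O : Outcome ((M + b * M) + M) (M + (α * N + b * m))) where
    open Outcome O

    bins≡ : M + (α * N + b * m) ≡ N * (k * (α + b) + α)
    bins≡ = solve 4 (λ α b k N → α :* (k :* N) :+ (α :* N :+ b :* (k :* N)) := N :* (k :* (α :+ b) :+ α)) refl α b k N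
      where open +-*-Solver

    used : OnlineAlgorithm.binsUsed A (map toItem ws) ≡ (2 + b) * M
    used = trans (reaches⇒binsUsed {ws} reaches) (trans opened (+-comm (M + b * M) M))

    lower : ∀ (P : Packing (map toItem ws)) → N ≤ Packing.size P
    lower P = *-cancelʳ-≤ N (Packing.size P) D (≤-trans volume (volume-bound d D 0<d P))

    bins↭ : concat (map (map toItem) bins) ↭ map toItem ws
    bins↭ = ↭-trans (↭-reflexive (Listₚ.concat-map {f = toItem} bins)) (map⁺ toItem (↭-sym perm))

    feasible : All Feasible (map (map toItem) bins)
    feasible = Allₚ.map⁺ (All.map (λ {b} → fit⇒feasible {b}) fit)

    number≤ : length (map (map toItem) bins) ≤ N * (k * (α + b) + α)
    number≤ = ≤-reflexive (trans (Listₚ.length-map (map toItem) bins) (trans number bins≡))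

    upper : ∃[ P ] Packing.size {L = map toItem ws} P ≤ N * (k * (α + b) + α)
    upper = packing {L = map toItem ws} (map (map toItem) bins) number≤ bins↭ feasible

    realize : HardInput A α b k N
    realize = map toItem ws , used , upper , lower

  outcome : Outcome ((M + b * M) + M) (M + (α * N + b * m))
  outcome = final bα+1<d (phases α m refl b (<⇒≤ bα+1<d)
    (record { P = 0; t = M; f = α * N; q = 0; P+t≡ = refl; f+q≡ = +-identityʳ _; state = opening }))

  hardInput : HardInput A α b k N
  hardInput = realize outcome

adversary : ∀ {d} (A : OnlineAlgorithm d) α b k N → 0 ℕ.< α → α * b + 2 ≤ d → 0 ℕ.< k → HardInput A α b k N
adversary {d} A α b k N 0<α αb+2≤d 0<k = scale (Gap-exists K {{K≢0}} rounds 1)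
  where
  K rounds : ℕ
  K      = k + d
  -- With M = α k N: k M rounds for the opening, M for each of the b α stages, and M for the last
  -- stage.
  rounds = k * (α * (k * N)) + (b * (α * (α * (k * N))) + (α * (k * N) + 0))

  K≢0 : NonZero K
  K≢0 = >-nonZero (≤-trans 0<k (m≤m+n k d))

  scale : ∃[ H ] Gap K {{K≢0}} rounds 1 H → HardInput A α b k N
  scale (H , gap) = Scaled.hardInput d (k * u) K H k N α b u {{>-nonZero (≤-trans 0<u u≤D)}} {{K≢0}} A ≤-refl
    (≤-trans (+-monoʳ-≤ H (m≤m+n H (K * H))) u≤D)
    (≤-trans (≤-trans (m≤n+m (K * H) H) (m≤n+m (H + K * H) H)) u≤D)
    0<α αb+2≤d 0<k 0<u refl gap
    where
    -- The summands give `H + H ≤ u` and `K * H ≤ u`, and `D = k * u` makes `u` the k-th part of a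
    -- unit.
    u : ℕ
    u = H + (H + K * H)
    0<u : 0 ℕ.< u
    0<u = ≤-trans (≤-<-trans z≤n (Gap⇒< K {{K≢0}} rounds gap)) (m≤m+n H _)
    u≤D : u ≤ k * u
    u≤D = m≤n*m u k {{>-nonZero 0<k}}

-- Comparison of the forced ratio with the bound.

/≤⇒ : ∀ a n .{{_ : NonZero n}} {q} → + a / n ℚ.≤ q → + a ℤ.* ℚ.↧ q ℤ.≤ ℚ.↥ q ℤ.* + n
/≤⇒ a (suc n) {mkℚ _ _ _} a/n≤q = ℚᵘₚ.drop-*≤* (ℚᵘₚ.≤-respˡ-≃ (toℚᵘ-/ a n) (ℚₚ.toℚᵘ-mono-≤ a/n≤q))

</⇒ : ∀ a n .{{_ : NonZero n}} {q} → q ℚ.< + a / n → ℚ.↥ q ℤ.* + n ℤ.< + a ℤ.* ℚ.↧ q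
</⇒ a (suc n) {mkℚ _ _ _} q<a/n = ℚᵘₚ.drop-*<* (ℚᵘₚ.<-respʳ-≃ (toℚᵘ-/ a n) (ℚₚ.toℚᵘ-mono-< q<a/n))

-- Used with p = α + β - 2 and c = α β: if u / v < c / p, then the forced ratio
-- c k / (k p + α) exceeds u / v as soon as k > u α.
ratio-too-large : ∀ u v p α c N n → u * p ℕ.< c * v →
  (c * (suc (u * α) * suc N)) * v ≤ u * n → n ≤ suc N * (suc (u * α) * p + α) → ⊥
ratio-too-large u v p α c N n up<cv used n≤ = 1+n≰n k≤uα
  where
  k = suc (u * α)
  open ≤-Reasoning
  scaled : suc N * (k * (c * v)) ≤ suc N * (u * (k * p + α))
  scaled = begin
    suc N * (k * (c * v))          ≡⟨ solve 4 (λ N k c v → N :* (k :* (c :* v)) := (c :* (k :* N)) :* v) refl (suc N) k c v ⟩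
    (c * (k * suc N)) * v          ≤⟨ used ⟩
    u * n                          ≤⟨ *-monoʳ-≤ u n≤ ⟩
    u * (suc N * (k * p + α))      ≡⟨ solve 3 (λ u N x → u :* (N :* x) := N :* (u :* x)) refl u (suc N) (k * p + α) ⟩
    suc N * (u * (k * p + α))      ∎
    where open +-*-Solver
  k≤uα : k ≤ u * α
  k≤uα = +-cancelʳ-≤ (k * (u * p)) k (u * α) (begin
    k + k * (u * p)        ≡⟨ *-suc k (u * p) ⟨
    k * suc (u * p)        ≤⟨ *-monoʳ-≤ k up<cv ⟩
    k * (c * v)            ≤⟨ *-cancelˡ-≤ (suc N) scaled ⟩
    u * (k * p + α)        ≡⟨ solve 4 (λ u k p α → u :* (k :* p :+ α) := u :* α :+ k :* (u :* p)) refl u k p α ⟩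
    u * α + k * (u * p)    ∎)
    where open +-*-Solver

-- The numerator `u` of the supposed bound may be negative; taking `k` from its absolute value lets
-- one input handle both signs.
ratio-too-large-ℤ : ∀ α b u v K₀ n → u ℤ.* + (α + b) ℤ.< + (α * (2 + b)) ℤ.* + v →
  (let k = suc (ℤ.∣ u ∣ * α); N = suc K₀) →
  + ((2 + b) * (α * (k * N))) ℤ.* + v ℤ.≤ u ℤ.* + n → n ≤ N * (k * (α + b) + α) → N ≤ n → ⊥
ratio-too-large-ℤ α b (+ u) v K₀ n lt used n≤ _ = ratio-too-large u v (α + b) α (α * (2 + b)) K₀ n
  (ℤₚ.drop‿+<+ (subst₂ ℤ._<_ (sym (ℤₚ.pos-* u (α + b))) (sym (ℤₚ.pos-* (α * (2 + b)) v)) lt))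
  (≤-trans (≤-reflexive (cong (_* v) c*kN≡))
    (ℤₚ.drop‿+≤+ (subst₂ ℤ._≤_ (sym (ℤₚ.pos-* ((2 + b) * (α * kN)) v)) (sym (ℤₚ.pos-* u n)) used)))
  n≤
  where
  kN : ℕ
  kN = suc (u * α) * suc K₀
  c*kN≡ : α * (2 + b) * kN ≡ (2 + b) * (α * kN)
  c*kN≡ = trans (cong (_* kN) (*-comm α (2 + b))) (*-assoc (2 + b) α kN)
-- A negative number cannot bound a ratio of naturals. `N ≤ n` excludes `n = 0`, so the right-hand
-- side is strictly negative.
ratio-too-large-ℤ α b -[1+ u ] v K₀ (suc n) _ used _ _ =
  absurd (subst (ℤ._≤ -[1+ u ] ℤ.* + suc n) (sym (ℤₚ.pos-* used-bins v)) used)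
  where
  used-bins : ℕ
  used-bins = (2 + b) * (α * (suc (suc u * α) * suc K₀))
  absurd : ∀ {x y} → ¬ (+ x ℤ.≤ -[1+ y ])
  absurd ()

theorem9 : (α β d : ℕ) (2≤α : 2 ≤ α) (2≤β : 2 ≤ β) → α * (β ∸ 2) + 2 ≤ d →
    ¬ (∃[ A ] asymptoticRatio {d} A < lowerBound α β 2≤α 2≤β)
theorem9 α (suc zero) d _ (s≤s ())
theorem9 α β@(suc (suc b)) d 2≤α 2≤β dim (A , q , (K₀ , bounds) , q<) =
  -- `N = suc K₀` makes OPT positive and at least `K₀`, so `bounds` applies; `k` exceeds the
  -- absolute value of the numerator of `q` times `α`, which makes the loss M/k small enough.
  refute (adversary A α b (suc (ℤ.∣ ℚ.↥ q ∣ * α)) (suc K₀) (<⇒≤ 2≤α) dim (s≤s z≤n))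
  where
  q<′ : ℚ.↥ q ℤ.* + (α + b) ℤ.< + (α * β) ℤ.* ℚ.↧ q
  q<′ = subst (λ n → ℚ.↥ q ℤ.* n ℤ.< + (α * β) ℤ.* ℚ.↧ q) (cong (λ n → + (n ∸ 2)) (x∙yz≈y∙xz α 2 b))
    (</⇒ (α * β) (α + β ∸ 2) {{α+β∸2≢0 α β 2≤α 2≤β}} (subst (q ℚ.<_) (lowerBound≡lowerBound′ α β 2≤α 2≤β) q<))

  refute : ¬ HardInput A α b (suc (ℤ.∣ ℚ.↥ q ∣ * α)) (suc K₀)
  refute (L , used , (P₀ , P₀≤) , N≤) = ¬¬IsOPT P₀ λ n opt@((P , size≡n) , n≤) →
    let N≤n = ≤-trans (N≤ P) (≤-reflexive size≡n)
        n≢0 = >-nonZero (≤-trans (s≤s z≤n) N≤n)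
    in ratio-too-large-ℤ α b (ℚ.↥ q) (ℚ.↧ₙ q) K₀ n q<′
         (subst (λ a → + a ℤ.* ℚ.↧ q ℤ.≤ ℚ.↥ q ℤ.* + n) used
           (/≤⇒ (OnlineAlgorithm.binsUsed A L) n {{n≢0}} (bounds K₀ ≤-refl _ (ratio L n {{n≢0}} opt (<⇒≤ N≤n)))))
         (≤-trans (n≤ P₀) P₀≤) N≤n
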